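{- Let $P$ be an MTS over a set of actions $A$ and let $\varphi$ be a Boudol-Larsen modal formula over $A$. Then for each $p\in P$: $(P,p)\models\varphi$ if and only if $(\mathcal{C}(P),p)\models\mathcal{C}(\varphi)$.
   Context: A modal transition system (MTS) over a set of actions $A$ is a triple $(P,\to_\Diamond,\to_\Box)$ with $P$ a set of states and $\to_\Box\subseteq\to_\Diamond\subseteq P\times A\times P$ (must transitions $\to_\Box$, may transitions $\to_\Diamond$). A labelled transition system (LTS) is a set of states with a labelled transition relation $\to$; a signature is a partition $\{A^r,A^l,A^{bi}\}$ of its action set into pairwise disjoint, possibly empty sets. Boudol-Larsen formulae over $A$: $\varphi::=\bot\mid\top\mid\varphi\wedge\varphi\mid\varphi\vee\varphi\mid[a]\varphi\mid\langle a\rangle\varphi$ ($a\in A$), interpreted at a state $p$ of an MTS $P$: $\top$ always holds, $\bot$ never, $\wedge,\vee$ as usual; $(P,p)\models[a]\varphi$ iff $(P,p')\models\varphi$ for all $p\xrightarrow{a}_\Diamond p'$; $(P,p)\models\langle a\rangle\varphi$ iff $(P,p')\models\varphi$ for some $p\xrightarrow{a}_\Box p'$. Covariant-contravariant formulae over $\{A^r,A^l,A^{bi}\}$: $\varphi::=\bot\mid\top\mid\varphi\wedge\varphi\mid\varphi\vee\varphi\mid[b]\varphi\mid\langle a\rangle\varphi$ ($a\in A^r\cup A^{bi}$, $b\in A^l\cup A^{bi}$), interpreted at a state $p$ of an LTS $P$: Boolean cases as usual; $(P,p)\models[b]\varphi$ iff $(P,p')\models\varphi$ for all $p\xrightarrow{b}p'$;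 $(P,p)\models\langle a\rangle\varphi$ iff $(P,p')\models\varphi$ for some $p\xrightarrow{a}p'$. For an MTS $M$ over $A$, the LTS $\mathcal{C}(M)$ has signature $A^r=\{\mathrm{cv}(a)\mid a\in A\}$, $A^l=\{\mathrm{ct}(a)\mid a\in A\}$, $A^{bi}=\emptyset$ (where $\mathrm{cv}(a),\mathrm{ct}(a)$ are two disjoint copies of the actions), the same states as $M$, and exactly the transitions $p\xrightarrow{\mathrm{ct}(a)}p'$ for each $p\xrightarrow{a}_\Diamond p'$ in $M$ and $p\xrightarrow{\mathrm{cv}(a)}p'$ for each $p\xrightarrow{a}_\Box p'$ in $M$. On formulae, $\mathcal{C}$ maps Boudol-Larsen formulae over $A$ to covariant-contravariant formulae over that signature: $\mathcal{C}(\bot)=\bot$, $\mathcal{C}(\top)=\top$, $\mathcal{C}(\varphi\wedge\psi)=\mathcal{C}(\varphi)\wedge\mathcal{C}(\psi)$, $\mathcal{C}(\varphi\vee\psi)=\mathcal{C}(\varphi)\vee\mathcal{C}(\psi)$, $\mathcal{C}(\langle a\rangle\varphi)=\langle\mathrm{cv}(a)\rangle\mathcal{C}(\varphi)$, $\mathcal{C}([a]\varphi)=[\mathrm{ct}(a)]\mathcal{C}(\varphi)$. -}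

module Defs where

open import Level using (Level; _⊔_; suc)
import Data.Empty.Polymorphic as Empty
import Data.Unit.Polymorphic as Unit
open import Data.Product using (_×_; _,_; ∃-syntax)
open import Data.Sum using (_⊎_; inj₁; inj₂)
open import Relation.Binary.PropositionalEquality using (_≡_; refl)
open import Relation.Unary using (Pred; _∈_; _∪_; _∩_; Empty; Universal)
open import Relation.Unary.Polymorphic using (∅)

private
  variable
    a s p t : Level

record MTS (A : Set a) (p t : Level) : Set (a ⊔ suc (p ⊔ t)) where
  field
    State   : Set p
    May     : State → A → State → Set t
    Must    : State → A → State → Set t
    must⊆may : ∀ {x b y} → Must x b y → May x b y

infixr 6 _∧_
infixr 5 _∨_
infixr 7 [_]_ ⟨_⟩_ [_∶_]_ ⟨_∶_⟩_
infix  4 _,_⊨ᴮᴸ_ _,_⊨ᶜᶜ_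

data BLFormula (A : Set a) : Set a where
  ⊥ ⊤     : BLFormula A
  _∧_ _∨_ : BLFormula A → BLFormula A → BLFormula A
  [_]_    : A → BLFormula A → BLFormula A
  ⟨_⟩_    : A → BLFormula A → BLFormula A

_,_⊨ᴮᴸ_ : {A : Set a} (M : MTS A p t) → MTS.State M → BLFormula A → Set (p ⊔ t)
M , x ⊨ᴮᴸ ⊥         = Empty.⊥
M , x ⊨ᴮᴸ ⊤         = Unit.⊤
M , x ⊨ᴮᴸ (φ ∧ ψ)   = (M , x ⊨ᴮᴸ φ) × (M , x ⊨ᴮᴸ ψ)
M , x ⊨ᴮᴸ (φ ∨ ψ)   = (M , x ⊨ᴮᴸ φ) ⊎ (M , x ⊨ᴮᴸ ψ)
M , x ⊨ᴮᴸ ([ b ] φ) = ∀ y → MTS.May M x b y → M , y ⊨ᴮᴸ φ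
M , x ⊨ᴮᴸ (⟨ b ⟩ φ) = ∃[ y ] (MTS.Must M x b y × (M , y ⊨ᴮᴸ φ))

record Signature (A : Set a) (s : Level) : Set (a ⊔ suc s) where
  field
    Aʳ Aˡ Aᵇⁱ      : Pred A s
    exhaustive     : Universal (Aʳ ∪ Aˡ ∪ Aᵇⁱ)
    disjoint-r-l   : Empty (Aʳ ∩ Aˡ)
    disjoint-r-bi  : Empty (Aʳ ∩ Aᵇⁱ)
    disjoint-l-bi  : Empty (Aˡ ∩ Aᵇⁱ)

record LTS {A : Set a} (Σ : Signature A s) (p t : Level) : Set (a ⊔ suc (p ⊔ t)) where
  field
    State : Set p
    Trans : State → A → State → Set t

-- The side conditions on actions are irrelevant arguments, so that a formula
-- is determined by its syntax alone.
data CCFormula {A : Set a} (Σ : Signature A s) : Set (a ⊔ s) where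
  ⊥ ⊤     : CCFormula Σ
  _∧_ _∨_ : CCFormula Σ → CCFormula Σ → CCFormula Σ
  [_∶_]_  : (b : A) → .(b ∈ Signature.Aˡ Σ ∪ Signature.Aᵇⁱ Σ) → CCFormula Σ → CCFormula Σ
  ⟨_∶_⟩_  : (b : A) → .(b ∈ Signature.Aʳ Σ ∪ Signature.Aᵇⁱ Σ) → CCFormula Σ → CCFormula Σ

_,_⊨ᶜᶜ_ : {A : Set a} {Σ : Signature A s} (L : LTS Σ p t) →
          LTS.State L → CCFormula Σ → Set (p ⊔ t)
L , x ⊨ᶜᶜ ⊥             = Empty.⊥
L , x ⊨ᶜᶜ ⊤             = Unit.⊤
L , x ⊨ᶜᶜ (φ ∧ ψ)       = (L , x ⊨ᶜᶜ φ) × (L , x ⊨ᶜᶜ ψ)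
L , x ⊨ᶜᶜ (φ ∨ ψ)       = (L , x ⊨ᶜᶜ φ) ⊎ (L , x ⊨ᶜᶜ ψ)
L , x ⊨ᶜᶜ ([ b ∶ _ ] φ) = ∀ y → LTS.Trans L x b y → L , y ⊨ᶜᶜ φ
L , x ⊨ᶜᶜ (⟨ b ∶ _ ⟩ φ) = ∃[ y ] (LTS.Trans L x b y × (L , y ⊨ᶜᶜ φ))

data CvCt (A : Set a) : Set a where
  cv ct : A → CvCt A

cvct : (A : Set a) → Signature (CvCt A) a
cvct A = record
  { Aʳ            = λ c → ∃[ b ] c ≡ cv b
  ; Aˡ            = λ c → ∃[ b ] c ≡ ct b
  ; Aᵇⁱ           = ∅
  ; exhaustive    = λ { (cv b) → inj₁ (b , refl) ; (ct b) → inj₂ (inj₁ (b , refl)) }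
  ; disjoint-r-l  = λ { _ ((_ , refl) , (_ , ())) }
  ; disjoint-r-bi = λ { _ (_ , ()) }
  ; disjoint-l-bi = λ { _ (_ , ()) }
  }

𝒞 : {A : Set a} → MTS A p t → LTS (cvct A) p t
𝒞 {A = A} M = record { State = State ; Trans = Trans }
  where
  open MTS M
  Trans : State → CvCt A → State → Set _
  Trans x (ct b) y = May x b y
  Trans x (cv b) y = Must x b y

𝒞ᶠ : {A : Set a} → BLFormula A → CCFormula (cvct A)
𝒞ᶠ ⊥         = ⊥
𝒞ᶠ ⊤         = ⊤
𝒞ᶠ (φ ∧ ψ)   = 𝒞ᶠ φ ∧ 𝒞ᶠ ψ
𝒞ᶠ (φ ∨ ψ)   = 𝒞ᶠ φ ∨ 𝒞ᶠ ψ
𝒞ᶠ (⟨ b ⟩ φ) = ⟨ cv b ∶ inj₁ (b , refl) ⟩ 𝒞ᶠ φ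
𝒞ᶠ ([ b ] φ) = [ ct b ∶ inj₁ (b , refl) ] 𝒞ᶠ φ

{-# OPTIONS --safe #-}
module Submission where

open import Defs
open import Level using (Level)
open import Data.Product using (map₂)
open import Data.Product.Function.NonDependent.Propositional using (_×-⇔_)
open import Data.Sum.Function.Propositional using (_⊎-⇔_)
open import Function.Bundles using (_⇔_; mk⇔; module Equivalence)
open import Function.Construct.Identity using (⇔-id)

open Equivalence using (to; from)

-- Structural induction on `φ`, uniformly in the state: `𝒞` keeps the states and merely relabels may
-- steps by `ct` and must steps by `cv`, so the two satisfaction clauses for each connective agree
-- up to the induction hypothesis.

proposition9 : {a p t : Level} {A : Set a} (P : MTS A p t) (φ : BLFormula A) →
    (x : MTS.State P) → (P , x ⊨ᴮᴸ φ) ⇔ (𝒞 P , x ⊨ᶜᶜ 𝒞ᶠ φ)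
proposition9 P ⊥         x = ⇔-id _
proposition9 P ⊤         x = ⇔-id _
proposition9 P (φ ∧ ψ)   x = proposition9 P φ x ×-⇔ proposition9 P ψ x
proposition9 P (φ ∨ ψ)   x = proposition9 P φ x ⊎-⇔ proposition9 P ψ x
-- `r` serves both sides as is: a `ct b` transition of `𝒞 P` reduces to `May`.
proposition9 P ([ b ] φ) x = mk⇔
  (λ h y r → to   (proposition9 P φ y) (h y r))
  (λ h y r → from (proposition9 P φ y) (h y r))
-- Successor and must step are kept, as `cv b` reduces to `Must`; only satisfaction at `y` is
-- transported.
proposition9 P (⟨ b ⟩ φ) x = mk⇔
  (map₂ λ {y} → map₂ (to   (proposition9 P φ y)))
  (map₂ λ {y} → map₂ (from (proposition9 P φ y)))
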